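{- For any positive integer $k$, there exists an intersecting $k$-family $\mathcal{M}_k$ of transversal size $\lceil \frac{k+1}{2} \rceil$ and length $k+1$. Furthermore, the number of vertices in this family is equal to $k(k+1)/2$.
   Context: A $k$-set is a set with $k$ elements. A $k$-family is a collection of $k$-sets; its members are called blocks, and its length (or size) is the number of blocks in it. The set of vertices of a $k$-family $\mathcal{F}$ is $\bigcup_{F \in \mathcal{F}} F$. A $k$-family $\mathcal{F}$ is intersecting if $F \cap G \neq \emptyset$ for all $F, G \in \mathcal{F}$. A set $C$ is a covering set of $\mathcal{F}$ if $C \cap F \neq \emptyset$ for all $F \in \mathcal{F}$. The transversal size of $\mathcal{F}$ is the smallest possible integer $t$ such that there exists a $t$-set that is a covering set of $\mathcal{F}$. -}

module Defs where

open import Data.Fin.Subset using (Subset; _∩_; ⋃; ∣_∣; Nonempty)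
open import Data.List using (List; length)
open import Data.List.Membership.Propositional using (_∈_)
open import Data.List.Relation.Unary.Unique.Propositional using (Unique)
open import Data.Nat using (ℕ; _≤_)
open import Data.Product using (_×_; ∃-syntax)
open import Relation.Binary.PropositionalEquality using (_≡_)

IsSet : ∀ {n} → ℕ → Subset n → Set
IsSet k B = ∣ B ∣ ≡ k

-- A collection of k-sets drawn from the ambient set Fin n. The list may contain
-- repetitions; families without repeated blocks are singled out by Distinct.
record Family (n k : ℕ) : Set where
  field
    blocks  : List (Subset n)
    uniform : ∀ {B} → B ∈ blocks → IsSet k B

open Family public

module _ {n k : ℕ} where

  size : Family n k → ℕ
  size F = length (blocks F)

  Distinct : Family n k → Set
  Distinct F = Unique (blocks F)

  -- The ambient Fin n may contain points lying in no block; those are not vertices.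
  vertices : Family n k → Subset n
  vertices F = ⋃ (blocks F)

  Intersecting : Family n k → Set
  Intersecting F = ∀ {A B} → A ∈ blocks F → B ∈ blocks F → Nonempty (A ∩ B)

  Covers : Subset n → Family n k → Set
  Covers C F = ∀ {B} → B ∈ blocks F → Nonempty (C ∩ B)

  HasCoverOfSize : Family n k → ℕ → Set
  HasCoverOfSize F t = ∃[ C ] (IsSet t C × Covers C F)

  IsTransversalSize : Family n k → ℕ → Set
  IsTransversalSize F t = HasCoverOfSize F t × (∀ s → HasCoverOfSize F s → t ≤ s)

{-# OPTIONS --safe #-}

-- The vertices are the edges of the complete graph on k + 1 nodes, and the
-- blocks are the stars of its nodes. Two stars share the edge joining their
-- centres; each edge lies in exactly two stars, so a covering set needs at
-- least (k + 1)/2 edges, and a maximum matching (plus one more edge when k + 1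
-- is odd) attains this bound.
module Submission where

open import Data.Bool using (_∧_)
open import Data.Fin using (Fin; zero; suc; _↑ˡ_; _↑ʳ_; splitAt)
open import Data.Fin.Properties using (join-splitAt)
open import Data.Fin.Subset using (∣_∣; Subset; inside; outside; _∈_; ⊤; ⊥; ⁅_⁆; _∩_; ⋃; Nonempty)
open import Data.Fin.Subset.Properties using (∣⊥∣≡0; ∣⊤∣≡n; ∣⁅x⁆∣≡1; ∈⊤; x∈⁅x⁆; x∈⁅y⁆⇒x≡y; ∩-identityʳ; ∩-zeroʳ; x∈p∩q⁺; x∈p∩q⁻; p⊆p∪q; q⊆p∪q; p⊆q⇒∣p∣≤∣q∣; ∣p∣≤n)
open import Data.List as List using (tabulate)
open import Data.List.Membership.Propositional as List using ()
open import Data.List.Membership.Propositional.Properties using (∈-tabulate⁺; ∈-tabulate⁻)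
open import Data.List.Properties using (length-tabulate)
import Data.List.Relation.Unary.Any as Any
open import Data.List.Relation.Unary.Unique.Propositional.Properties using (tabulate⁺)
open import Data.Nat using (ℕ; _+_; _*_; _≤_; ⌈_/2⌉; zero; suc; z≤n; s≤s)
open import Data.Nat.DivMod using (_/_; m*n/n≡m)
open import Data.Nat.Properties using (+-0-commutativeMonoid; +-comm; +-identityʳ; +-mono-≤; ≤-antisym; ⌈n/2⌉-mono; n≡⌈n+n/2⌉; module ≤-Reasoning)
open import Data.Nat.Tactic.RingSolver using (solve-∀)
open import Data.Product using (_×_; ∃-syntax; Σ-syntax; _,_)
open import Data.Sum using (inj₁; inj₂)
open import Data.Vec as Vec using ([]; _∷_; _++_; here; there)
open import Data.Vec.Properties using (++-injectiveˡ; zipWith-++)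
open import Relation.Binary.PropositionalEquality using (_≡_; _≢_; refl; sym; trans; cong; cong₂; subst; module ≡-Reasoning)
open import Relation.Nullary using (contradiction)
open import Defs

open import Algebra.Properties.CommutativeMonoid.Sum +-0-commutativeMonoid using (sum; sum-cong-≗; ∑-distrib-+)

private
  variable
    m n : ℕ

∈-++⁺ˡ : ∀ {x : Fin m} {p} (q : Subset n) → x ∈ p → x ↑ˡ n ∈ p ++ q
∈-++⁺ˡ q here        = here
∈-++⁺ˡ q (there x∈p) = there (∈-++⁺ˡ q x∈p)

∈-++⁺ʳ : ∀ (p : Subset m) {x : Fin n} {q} → x ∈ q → m ↑ʳ x ∈ p ++ q
∈-++⁺ʳ []      x∈q = x∈q
∈-++⁺ʳ (_ ∷ p) x∈q = there (∈-++⁺ʳ p x∈q)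

∩-nonempty-++ˡ : ∀ {p q : Subset m} (r s : Subset n) →
                 Nonempty (p ∩ q) → Nonempty ((p ++ r) ∩ (q ++ s))
∩-nonempty-++ˡ {p = p} {q} r s (x , x∈p∩q) with x∈p∩q⁻ p q x∈p∩q
... | x∈p , x∈q = _ , x∈p∩q⁺ (∈-++⁺ˡ r x∈p , ∈-++⁺ˡ s x∈q)

∩-nonempty-++ʳ : ∀ (p q : Subset m) {r s : Subset n} →
                 Nonempty (r ∩ s) → Nonempty ((p ++ r) ∩ (q ++ s))
∩-nonempty-++ʳ p q {r} {s} (x , x∈r∩s) with x∈p∩q⁻ r s x∈r∩s
... | x∈r , x∈s = _ , x∈p∩q⁺ (∈-++⁺ʳ p x∈r , ∈-++⁺ʳ q x∈s)

∣p++q∣≡∣p∣+∣q∣ : ∀ (p : Subset m) (q : Subset n) → ∣ p ++ q ∣ ≡ ∣ p ∣ + ∣ q ∣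
∣p++q∣≡∣p∣+∣q∣ []            q = refl
∣p++q∣≡∣p∣+∣q∣ (inside  ∷ p) q = cong suc (∣p++q∣≡∣p∣+∣q∣ p q)
∣p++q∣≡∣p∣+∣q∣ (outside ∷ p) q = ∣p++q∣≡∣p∣+∣q∣ p q

∣++∩++∣ : ∀ (p q : Subset m) (r s : Subset n) →
          ∣ (p ++ r) ∩ (q ++ s) ∣ ≡ ∣ p ∩ q ∣ + ∣ r ∩ s ∣
∣++∩++∣ p q r s =
  trans (cong ∣_∣ (zipWith-++ _∧_ p r q s)) (∣p++q∣≡∣p∣+∣q∣ (p ∩ q) (r ∩ s))

∣p∩⊥∣≡0 : ∀ (p : Subset n) → ∣ p ∩ ⊥ ∣ ≡ 0
∣p∩⊥∣≡0 {n} p = trans (cong ∣_∣ (∩-zeroʳ p)) (∣⊥∣≡0 n)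

nonempty⇒1≤∣p∣ : ∀ {p : Subset n} → Nonempty p → 1 ≤ ∣ p ∣
nonempty⇒1≤∣p∣ {p = inside  ∷ p} _                   = s≤s z≤n
nonempty⇒1≤∣p∣ {p = outside ∷ p} (suc x , there x∈p) = nonempty⇒1≤∣p∣ (x , x∈p)

⁅⁆-injective : ∀ {x y : Fin n} → ⁅ x ⁆ ≡ ⁅ y ⁆ → x ≡ y
⁅⁆-injective {x = x} {y} eq = x∈⁅y⁆⇒x≡y y (subst (x ∈_) eq (x∈⁅x⁆ x))

∈-⋃⁺ : ∀ {x : Fin n} {p ps} → p List.∈ ps → x ∈ p → x ∈ ⋃ ps
∈-⋃⁺ {ps = _ List.∷ ps} (Any.here refl)  x∈p = p⊆p∪q (⋃ ps) x∈p
∈-⋃⁺ {ps = q List.∷ ps} (Any.there p∈ps) x∈p = q⊆p∪q q (⋃ ps) (∈-⋃⁺ p∈ps x∈p)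

∑∣p∩⁅i⁆∣≡∣p∣ : ∀ (p : Subset n) → sum (λ i → ∣ p ∩ ⁅ i ⁆ ∣) ≡ ∣ p ∣
∑∣p∩⁅i⁆∣≡∣p∣ []            = refl
∑∣p∩⁅i⁆∣≡∣p∣ (inside  ∷ p) = cong suc (cong₂ _+_ (∣p∩⊥∣≡0 p) (∑∣p∩⁅i⁆∣≡∣p∣ p))
∑∣p∩⁅i⁆∣≡∣p∣ (outside ∷ p) = cong₂ _+_ (∣p∩⊥∣≡0 p) (∑∣p∩⁅i⁆∣≡∣p∣ p)

n≤∑ : ∀ (f : Fin n → ℕ) → (∀ i → 1 ≤ f i) → n ≤ sum f
n≤∑ {zero}  f 1≤f = z≤n
n≤∑ {suc n} f 1≤f = +-mono-≤ (1≤f zero) (n≤∑ (λ i → f (suc i)) (λ i → 1≤f (suc i)))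

-- Recursion instead of a closed formula lets an edge set split by `++` into the edges at node zero
-- and those among the other nodes, with no arithmetic on indices.
triangle : ℕ → ℕ
triangle zero    = 0
triangle (suc k) = suc k + triangle k

triangle*2 : ∀ k → triangle k * 2 ≡ k * (k + 1)
triangle*2 zero    = refl
triangle*2 (suc k) = begin
  (suc k + triangle k) * 2     ≡⟨ distrib k (triangle k) ⟩
  suc k * 2 + triangle k * 2   ≡⟨ cong (suc k * 2 +_) (triangle*2 k) ⟩
  suc k * 2 + k * (k + 1)      ≡⟨ regroup k ⟩
  suc k * (suc k + 1)          ∎
  where
  open ≡-Reasoning
  distrib : ∀ k t → (suc k + t) * 2 ≡ suc k * 2 + t * 2
  distrib = solve-∀
  regroup : ∀ k → suc k * 2 + k * (k + 1) ≡ suc k * (suc k + 1)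
  regroup = solve-∀

-- The stars of the complete graph on suc k nodes. Its edges are numbered so
-- that the first k of them join node zero to the other nodes in turn, and the
-- rest form the complete graph on those k nodes.
star : ∀ k → Fin (suc k) → Subset (triangle k)
star zero    _       = []
star (suc k) zero    = ⊤ {suc k} ++ ⊥
star (suc k) (suc i) = ⁅ i ⁆ ++ star k i

∣star∣≡k : ∀ k i → ∣ star k i ∣ ≡ k
∣star∣≡k zero    _       = refl
∣star∣≡k (suc k) zero    =
  trans (∣p++q∣≡∣p∣+∣q∣ (⊤ {suc k}) (⊥ {triangle k}))
    (trans (cong₂ _+_ (∣⊤∣≡n (suc k)) (∣⊥∣≡0 (triangle k))) (+-identityʳ (suc k)))
∣star∣≡k (suc k) (suc i) =
  trans (∣p++q∣≡∣p∣+∣q∣ ⁅ i ⁆ (star k i)) (cong₂ _+_ (∣⁅x⁆∣≡1 i) (∣star∣≡k k i))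

-- When one centre is node zero and the other is `suc j`, the common edge is number `j`; otherwise
-- the search moves to the smaller graph. The index is `suc k` because the only star of the one-node
-- graph is empty.
stars-meet : ∀ k i j → Nonempty (star (suc k) i ∩ star (suc k) j)
stars-meet k zero zero = zero , here
stars-meet k zero (suc j) =
  ∩-nonempty-++ˡ ⊥ (star k j) (j , x∈p∩q⁺ (∈⊤ , x∈⁅x⁆ j))
stars-meet k (suc i) zero =
  ∩-nonempty-++ˡ (star k i) ⊥ (i , x∈p∩q⁺ (x∈⁅x⁆ i , ∈⊤))
-- Recursion would reach that empty star, so the single edge is given directly.
stars-meet zero    (suc zero) (suc zero) = zero , here
stars-meet (suc k) (suc i)    (suc j)    = ∩-nonempty-++ʳ ⁅ i ⁆ ⁅ j ⁆ (stars-meet k i j)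

⊤≢⁅i⁆ : ∀ (i : Fin (suc (suc n))) → ⊤ ≢ ⁅ i ⁆
⊤≢⁅i⁆ {n} i eq with trans (sym (∣⊤∣≡n (suc (suc n)))) (trans (cong ∣_∣ eq) (∣⁅x⁆∣≡1 i))
... | ()

-- The edges at node zero already tell stars apart: node zero has all of them, at least two, and any
-- other node has exactly one, which identifies it. With a single edge, both of its ends have the
-- same star.
star-injective : ∀ k {i j} → star (suc (suc k)) i ≡ star (suc (suc k)) j → i ≡ j
star-injective k {zero}  {zero}  eq = refl
star-injective k {zero}  {suc j} eq = contradiction (++-injectiveˡ ⊤ ⁅ j ⁆ eq) (⊤≢⁅i⁆ j)
star-injective k {suc i} {zero}  eq = contradiction (sym (++-injectiveˡ ⁅ i ⁆ ⊤ eq)) (⊤≢⁅i⁆ i)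
star-injective k {suc i} {suc j} eq = cong suc (⁅⁆-injective (++-injectiveˡ ⁅ i ⁆ ⁅ j ⁆ eq))

edge∈star : ∀ k (e : Fin (triangle k)) → ∃[ i ] e ∈ star k i
edge∈star (suc k) e with splitAt (suc k) e | join-splitAt (suc k) (triangle k) e
... | inj₁ i | refl = zero , ∈-++⁺ˡ ⊥ (∈⊤ {x = i})
... | inj₂ f | refl with edge∈star k f
...   | i , f∈star = suc i , ∈-++⁺ʳ ⁅ i ⁆ f∈star

-- Double counting: an edge lies in the stars of its two ends. The edges in `D`, those at node zero,
-- are counted once by its star and once more by the singletons at the other nodes; `E` is counted
-- twice by induction.
∑∣C∩star∣ : ∀ k (C : Subset (triangle k)) → sum (λ i → ∣ C ∩ star k i ∣) ≡ ∣ C ∣ + ∣ C ∣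
∑∣C∩star∣ zero    [] = refl
∑∣C∩star∣ (suc k) C with Vec.splitAt (suc k) C
... | D , E , refl = begin
  ∣ (D ++ E) ∩ (⊤ {suc k} ++ ⊥) ∣ + sum (λ i → ∣ (D ++ E) ∩ (⁅ i ⁆ ++ star k i) ∣)
    ≡⟨ cong₂ _+_ (∣++∩++∣ D ⊤ E ⊥) (sum-cong-≗ (λ i → ∣++∩++∣ D ⁅ i ⁆ E (star k i))) ⟩
  (∣ D ∩ ⊤ ∣ + ∣ E ∩ ⊥ ∣) + sum (λ i → ∣ D ∩ ⁅ i ⁆ ∣ + ∣ E ∩ star k i ∣)
    ≡⟨ cong₂ _+_ (cong₂ _+_ (cong ∣_∣ (∩-identityʳ D)) (∣p∩⊥∣≡0 E))
         (∑-distrib-+ (λ i → ∣ D ∩ ⁅ i ⁆ ∣) (λ i → ∣ E ∩ star k i ∣)) ⟩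
  (∣ D ∣ + 0) + (sum (λ i → ∣ D ∩ ⁅ i ⁆ ∣) + sum (λ i → ∣ E ∩ star k i ∣))
    ≡⟨ cong ((∣ D ∣ + 0) +_) (cong₂ _+_ (∑∣p∩⁅i⁆∣≡∣p∣ D) (∑∣C∩star∣ k E)) ⟩
  (∣ D ∣ + 0) + (∣ D ∣ + (∣ E ∣ + ∣ E ∣))
    ≡⟨ regroup ∣ D ∣ ∣ E ∣ ⟩
  (∣ D ∣ + ∣ E ∣) + (∣ D ∣ + ∣ E ∣)
    ≡⟨ cong₂ _+_ (∣p++q∣≡∣p∣+∣q∣ D E) (∣p++q∣≡∣p∣+∣q∣ D E) ⟨
  ∣ D ++ E ∣ + ∣ D ++ E ∣ ∎
  where
  open ≡-Reasoning
  regroup : ∀ d e → (d + 0) + (d + (e + e)) ≡ (d + e) + (d + e)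
  regroup = solve-∀

-- Each of the `suc k` stars contributes at least 1 to a sum equal to twice the size of `C`; halving
-- with rounding up gives the bound.
star-cover-lower-bound : ∀ k (C : Subset (triangle k)) →
  (∀ i → Nonempty (C ∩ star k i)) → ⌈ k + 1 /2⌉ ≤ ∣ C ∣
star-cover-lower-bound k C covers = begin
  ⌈ k + 1 /2⌉           ≡⟨ cong ⌈_/2⌉ (+-comm k 1) ⟩
  ⌈ suc k /2⌉           ≤⟨ ⌈n/2⌉-mono (n≤∑ _ (λ i → nonempty⇒1≤∣p∣ (covers i))) ⟩
  ⌈ sum (λ i → ∣ C ∩ star k i ∣) /2⌉ ≡⟨ cong ⌈_/2⌉ (∑∣C∩star∣ k C) ⟩
  ⌈ ∣ C ∣ + ∣ C ∣ /2⌉   ≡⟨ n≡⌈n+n/2⌉ ∣ C ∣ ⟨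
  ∣ C ∣                 ∎
  where open ≤-Reasoning

-- Match nodes zero and one, and cover the stars of the others within the
-- complete graph on them; k = 0 has only the empty star, so k = 2 is a base case.
star-cover : ∀ k → 1 ≤ k →
  ∃[ C ] (∣ C ∣ ≡ ⌈ k + 1 /2⌉ × (∀ i → Nonempty (C ∩ star k i)))
star-cover 1 _ = ⊤ , refl , λ { zero → zero , here ; (suc zero) → zero , here }
-- Two edges of a triangle: a star covers because stars pairwise meet, and its size is 3/2 rounded
-- up.
star-cover 2 _ = star 2 zero , refl , stars-meet 1 zero
star-cover (suc (suc k@(suc _))) _ with star-cover k (s≤s z≤n)
... | C , ∣C∣≡ , covers = C′ , size≡ , covers′
  where
  C′ : Subset (triangle (suc (suc k)))
  -- The three segments are the edges at node zero, the remaining edges at node one, and the edges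
  -- among the other nodes. The singleton is the edge joining nodes zero and one.
  C′ = ⁅ zero {suc k} ⁆ ++ (⊥ {suc k} ++ C)
  size≡ : ∣ C′ ∣ ≡ suc ⌈ k + 1 /2⌉
  size≡ = trans (∣p++q∣≡∣p∣+∣q∣ ⁅ zero {suc k} ⁆ (⊥ {suc k} ++ C))
    (cong₂ _+_ (∣⁅x⁆∣≡1 (zero {suc k}))
      (trans (∣p++q∣≡∣p∣+∣q∣ (⊥ {suc k}) C) (cong₂ _+_ (∣⊥∣≡0 (suc k)) ∣C∣≡)))
  covers′ : ∀ i → Nonempty (C′ ∩ star (suc (suc k)) i)
  covers′ zero          = zero , here
  covers′ (suc zero)    = zero , here
  covers′ (suc (suc i)) = ∩-nonempty-++ʳ ⁅ zero {suc k} ⁆ ⁅ suc i ⁆ (∩-nonempty-++ʳ ⊥ ⁅ i ⁆ (covers i))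

stars : ∀ k → Family (triangle k) k
stars k .blocks = tabulate (star k)
stars k .uniform B∈ with ∈-tabulate⁻ {f = star _} B∈
... | i , refl = ∣star∣≡k k i

stars-intersecting : ∀ k → Intersecting (stars (suc k))
stars-intersecting k A∈ B∈ with ∈-tabulate⁻ {f = star _} A∈ | ∈-tabulate⁻ {f = star _} B∈
... | i , refl | j , refl = stars-meet k i j

stars-transversalSize : ∀ k → 1 ≤ k → IsTransversalSize (stars k) ⌈ k + 1 /2⌉
stars-transversalSize k 1≤k = attained (star-cover k 1≤k) , minimal
  where
  attained : ∃[ C ] (∣ C ∣ ≡ ⌈ k + 1 /2⌉ × (∀ i → Nonempty (C ∩ star k i))) →
             HasCoverOfSize (stars k) ⌈ k + 1 /2⌉
  attained (C , ∣C∣≡ , covers) = C , ∣C∣≡ , covers′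
    where
    covers′ : Covers C (stars k)
    covers′ B∈ with ∈-tabulate⁻ {f = star _} B∈
    ... | i , refl = covers i
  minimal : ∀ s → HasCoverOfSize (stars k) s → ⌈ k + 1 /2⌉ ≤ s
  minimal _ (C , refl , covers) =
    star-cover-lower-bound k C (λ i → covers (∈-tabulate⁺ {f = star k} i))

-- Every edge has an end, so it lies in some star and the blocks fill the whole ambient set.
∣vertices-stars∣ : ∀ k → ∣ vertices (stars k) ∣ ≡ triangle k
∣vertices-stars∣ k = ≤-antisym (∣p∣≤n (vertices (stars k)))
  (subst (_≤ ∣ vertices (stars k) ∣) (∣⊤∣≡n (triangle k)) (p⊆q⇒∣p∣≤∣q∣ {p = ⊤} ⊤⊆vertices))
  where
  ⊤⊆vertices : ∀ {e} → e ∈ ⊤ → e ∈ vertices (stars k)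
  ⊤⊆vertices {e} _ with edge∈star k e
  ... | i , e∈star = ∈-⋃⁺ (∈-tabulate⁺ {f = star k} i) e∈star

stars-distinct : ∀ k → 2 ≤ k → Distinct (stars k)
stars-distinct (suc (suc k)) _        = tabulate⁺ (star-injective k)
stars-distinct (suc zero)    (s≤s ())

lemma1p1 : ∀ (k : ℕ) → 1 ≤ k →
    ∃[ n ] Σ[ M ∈ Family n k ]
    ( Intersecting M
    × IsTransversalSize M ⌈ k + 1 /2⌉
    × size M ≡ k + 1
    × (2 ≤ k → Distinct M)
    × ∣ vertices M ∣ ≡ (k * (k + 1)) / 2 )
lemma1p1 k@(suc k′) 1≤k =
  triangle k , stars k ,
  stars-intersecting k′ ,
  stars-transversalSize k 1≤k ,
  trans (length-tabulate (star k)) (+-comm 1 k) ,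
  stars-distinct k ,
  trans (∣vertices-stars∣ k)
    -- The division is exact, since `k * (k + 1)` is twice `triangle k`.
    (trans (sym (m*n/n≡m (triangle k) 2)) (cong (_/ 2) (triangle*2 k)))
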